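{- Let $A$ be a nonempty finite set of positive integers, let $n$ be a positive integer, and let $\alpha$ be a positive integer with $\alpha\le |A|$. Then \[ (a)\quad \Phi(A,n)= \sum_{d\mid n}\mu(d)\, 2^{v(A,d)} = \sum_{d\mid n} \mu(d)\, |\mathcal{P}( V(A,d))|, \] \[ (b)\quad \Phi_{\alpha}(A,n)= \sum_{d\mid n}\mu(d) \binom{v(A,d)}{\alpha} = \sum_{d\mid n}\mu(d)\, | \mathcal{P}_{\alpha} ( V(A,d))|. \]
   Context: $\mu$ is the Möbius function. For a positive integer $d$, $V(A,d)$ is the set of multiples of $d$ in $A$ and $v(A,d)=|V(A,d)|$. For a set $X$, $\mathcal{P}(X)$ is its power set and $\mathcal{P}_\alpha(X)$ is the set of subsets of $X$ of cardinality $\alpha$. $\Phi(A,n)$ is the number of nonempty subsets $X\subseteq A$ with $\gcd(X\cup\{n\})=1$, and $\Phi_\alpha(A,n)$ is the number of subsets $X\subseteq A$ with $|X|=\alpha$ and $\gcd(X\cup\{n\})=1$. Binomial coefficients $\binom{m}{k}$ are $0$ when $k>m$.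
   Formalization: The first equality of (a) is stated only for n ≠ 1: for n = 1 it is false for every A, since Φ(A,1) = 2^|A| − 1 counts only nonempty subsets while the sum is 2^|A| (e.g. A = {1}: 1 versus 2). -}

module Defs where

open import Data.Bool.Base using (true; false; if_then_else_)
open import Data.Fin.Base using (Fin; toℕ)
open import Data.Fin.Subset using (Subset; Nonempty; inside; outside; ∣_∣; _∩_)
open import Data.Fin.Subset.Properties using (_∈?_; _⊆?_; nonempty?)
open import Data.Integer.Base as ℤ using (ℤ; +_; 0ℤ; -1ℤ)
open import Data.List.Base using (List; []; _∷_; _++_; map; filter; foldr; length; upTo; allFin)
open import Data.List.Membership.Propositional using (_∈_)
open import Data.List.Membership.Propositional.Properties
  using (∈-map⁺; ∈-map⁻; ∈-++⁺ˡ; ∈-++⁺ʳ)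
open import Data.List.Relation.Unary.Any using (here)
open import Data.List.Relation.Unary.All using ([])
open import Data.List.Relation.Unary.AllPairs using ([]; _∷_)
open import Data.List.Relation.Unary.Unique.Propositional using (Unique)
open import Data.List.Relation.Unary.Unique.Propositional.Properties using (map⁺; ++⁺)
open import Data.Nat.Base using (ℕ; zero; suc)
open import Data.Nat.Divisibility using (_∣?_)
open import Data.Nat.GCD using (gcd)
open import Data.Nat.Primality.Factorisation using (factors; factorise)
open import Data.Nat.Properties using (_≟_)
open import Data.List.Relation.Unary.Unique.DecPropositional _≟_ using (unique?)
open import Data.Product.Base using (_×_; _,_; ∃-syntax)
open import Data.Vec.Base as Vec using (tabulate)
open import Data.Vec.Properties using (∷-injectiveʳ)
open import Relation.Binary.PropositionalEquality.Core using (_≡_; refl)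
open import Relation.Nullary.Negation.Core using (¬_)
open import Relation.Nullary.Decidable using (does; _×-dec_)

-- A finite set of positive integers is given as a subset of {1, …, N} for
-- some N: the index i : Fin N stands for the positive integer toℕ i + 1.
value : ∀ {N} → Fin N → ℕ
value i = suc (toℕ i)

subsets : ∀ N → List (Subset N)
subsets zero    = Vec.[] ∷ []
subsets (suc N) = map (outside Vec.∷_) (subsets N) ++ map (inside Vec.∷_) (subsets N)

-- Every subset occurs in `subsets N` exactly once, so the length of a filtered
-- `subsets N` is the number of subsets satisfying the predicate.
subsets-complete : ∀ {N} (X : Subset N) → X ∈ subsets N
subsets-complete Vec.[]            = here refl
subsets-complete (false Vec.∷ X) = ∈-++⁺ˡ (∈-map⁺ (outside Vec.∷_) (subsets-complete X))
subsets-complete {suc N} (true Vec.∷ X) =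
  ∈-++⁺ʳ (map (outside Vec.∷_) (subsets N)) (∈-map⁺ (inside Vec.∷_) (subsets-complete X))

subsets-unique : ∀ N → Unique (subsets N)
subsets-unique zero    = [] ∷ []
subsets-unique (suc N) =
  ++⁺ (map⁺ ∷-injectiveʳ (subsets-unique N)) (map⁺ ∷-injectiveʳ (subsets-unique N))
      (λ (p , q) → heads-differ (∈-map⁻ _ p) (∈-map⁻ _ q))
  where
  heads-differ : ∀ {X : Subset (suc N)} →
    ∃[ Y ] Y ∈ subsets N × X ≡ outside Vec.∷ Y →
    ¬ (∃[ Z ] Z ∈ subsets N × X ≡ inside Vec.∷ Z)
  heads-differ (_ , _ , refl) (_ , _ , ())

𝒫 : ∀ {N} → Subset N → List (Subset N)
𝒫 {N} X = filter (_⊆? X) (subsets N)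

𝒫[_] : ∀ {N} → ℕ → Subset N → List (Subset N)
𝒫[ α ] X = filter (λ Y → ∣ Y ∣ ≟ α) (𝒫 X)

-- gcd (X ∪ {n})
gcd∪ : ∀ {N} → Subset N → ℕ → ℕ
gcd∪ {N} X n = foldr gcd n (map value (filter (_∈? X) (allFin N)))

V : ∀ {N} → Subset N → ℕ → Subset N
V A d = A ∩ tabulate (λ i → does (d ∣? value i))

v : ∀ {N} → Subset N → ℕ → ℕ
v A d = ∣ V A d ∣

-- Only nonempty X are counted. As gcd∪ of the empty set is n, this matters
-- exactly when n = 1: there Φ A 1 = 2 ^ ∣ A ∣ − 1, while ∑ μ(d) 2 ^ v A d
-- over d ∣ 1 is 2 ^ ∣ A ∣.
Φ : ∀ {N} → Subset N → ℕ → ℕ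
Φ A n = length (filter (λ X → nonempty? X ×-dec gcd∪ X n ≟ 1) (𝒫 A))

Φ[_] : ∀ {N} → ℕ → Subset N → ℕ → ℕ
Φ[ α ] A n = length (filter (λ X → gcd∪ X n ≟ 1) (𝒫[ α ] A))

-- The Möbius function; its value at 0 is a dummy. A positive integer is
-- squarefree iff no prime is repeated in its factorisation.
μ : ℕ → ℤ
μ zero      = 0ℤ
μ n@(suc _) = if does (unique? ps) then -1ℤ ℤ.^ length ps else 0ℤ
  where ps = factors (factorise n)

-- Intended for n > 0: the range 0 … n then contains every divisor of n, and
-- 0 itself is not one.
∑-divisors : ℕ → (ℕ → ℤ) → ℤ
∑-divisors n f = foldr ℤ._+_ 0ℤ (map f (filter (_∣? n) (upTo (suc n))))

infix 5 ∑-divisors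
syntax ∑-divisors n (λ d → e) = ∑[ d ∣ n ] e

{-# OPTIONS --safe #-}
-- Write D n for the set of divisors of n. Counting the pairs (d, X) with
-- d ∈ D n and X ⊆ V(A, d), weighted by μ(d), in two ways gives
--   ∑_{d ∣ n} μ(d) #{X ∈ L : X ⊆ V(A, d)} = ∑_{X ∈ L} ∑_{d ∣ gcd(X ∪ {n})} μ(d)
-- for every family L of subsets of A, and the inner sum on the right is 1 or 0
-- according as gcd(X ∪ {n}) is 1 or not. Take L to be the power set of A, or the
-- subsets of cardinality α.
--
-- That ∑_{d ∣ m} μ(d) vanishes for m > 1: choose a prime p with m = p k. The
-- divisors of m prime to p are the divisors of k prime to p, the others are the
-- p e with e ∣ k, and μ(p e) is − μ(e) or 0 according as p ∤ e or p ∣ e.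
module Submission where

open import Defs
open import Data.Fin.Subset using (Subset; Nonempty; ∣_∣)
open import Data.Integer.Base using (+_; _*_)
open import Data.List.Base using (length)
open import Data.Nat.Base using (ℕ; _≤_; _^_; NonZero)
open import Data.Nat.Combinatorics using (_C_)
open import Data.Product.Base using (_×_)
open import Relation.Binary.PropositionalEquality.Core using (_≡_; _≢_)

open import Data.Bool.Base using (true; false; if_then_else_)
open import Data.Fin.Subset as Subset using (inside; outside)
open import Data.Fin.Subset.Properties
  using (_∈?_; _⊆?_; nonempty?; drop-∷-⊆; out⊆; in⊆in; x∈p∩q⁺; x∈p∩q⁻)
open import Data.Integer.Base using (ℤ; _+_; -_; 0ℤ; 1ℤ; -1ℤ) renaming (_^_ to _^ℤ_)
import Data.Integer.Properties as ℤ
open import Data.Integer.Tactic.RingSolver using (solve-∀)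
open import Data.List.Base using (List; []; _∷_; _++_; map; filter; foldr; upTo; allFin)
open import Data.List.Properties
  using (++-identityʳ; filter-++; filter-≐; filter-none; length-++; length-map)
open import Data.List.Membership.Propositional using (_∈_)
open import Data.List.Membership.Propositional.Properties
  using (∈-map⁺; ∈-map⁻; ∈-++⁺ˡ; ∈-++⁺ʳ; ∈-++⁻; ∈-filter⁺; ∈-filter⁻; ∈-upTo⁺; ∈-allFin)
open import Data.List.Membership.Propositional.Properties.WithK using (unique∧set⇒bag)
open import Data.List.Relation.Binary.BagAndSetEquality using (∼bag⇒↭)
open import Data.List.Relation.Binary.Permutation.Propositional using (_↭_; ↭-sym; ↭⇒↭ₛ)
open import Data.List.Relation.Binary.Permutation.Propositional.Properties
  using (↭-length; map⁺)
import Data.List.Relation.Binary.Permutation.Setoid.Properties as Permutation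
open import Data.List.Relation.Unary.All as All using (All; []; _∷_)
open import Data.List.Relation.Unary.AllPairs using (_∷_)
open import Data.List.Relation.Unary.Any using (here; there)
open import Data.List.Relation.Unary.Unique.Propositional using (Unique)
import Data.List.Relation.Unary.Unique.Propositional.Properties as Unique
open import Data.Nat.Base as ℕ using (zero; suc; s≤s)
open import Data.Nat.Combinatorics using (nCk+nC[k+1]≡[n+1]C[k+1])
open import Data.Nat.Divisibility
  using (_∣_; _∣?_; divides; ∣-trans; ∣-antisym; ∣-refl; ∣⇒≤; m∣m*n; ∣n⇒∣m*n; *-monoʳ-∣;
         *-cancelˡ-∣; 0∣⇒≡0)
open import Data.Nat.GCD using (gcd; gcd-greatest; gcd[m,n]∣m; gcd[m,n]∣n)
open import Data.Nat.ListAction.Properties using (∈⇒∣product)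
open import Data.Nat.Primality using (Prime; prime⇒nonZero; euclidsLemma)
open import Data.Nat.Primality.Factorisation
  using (PrimeFactorisation; factors; factorise; factorisationUnique;
         factorisationHasAllPrimeFactors)
import Data.Nat.Properties as ℕ
open import Data.List.Relation.Unary.Unique.DecPropositional ℕ._≟_ using (unique?)
open import Data.Product.Base using (_,_; proj₁; proj₂)
open import Data.Sum.Base using (inj₁; inj₂)
import Data.Vec.Base as Vec
open import Data.Vec.Properties using (lookup∘tabulate; lookup⇒[]=; []=⇒lookup)
open import Function.Base using (_∘_)
open import Function.Bundles using (mk⇔)
open import Level using (0ℓ)
open import Relation.Binary.PropositionalEquality.Core
  using (refl; sym; trans; cong; cong₂; subst)
open import Relation.Binary.PropositionalEquality.Properties using (setoid; module ≡-Reasoning)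
open import Relation.Nullary.Decidable
  using (Dec; yes; no; does; ¬?; _×-dec_; does-⇔; dec-true; dec-false)
open import Relation.Nullary.Negation using (¬_; contradiction)
open import Relation.Unary using (Pred; Decidable)

open PrimeFactorisation using (isFactorisation; factorsPrime)

-- Filters and lists without repetition

private
  variable
    A B : Set
    P Q : Pred A 0ℓ

filter-map : (P? : Decidable P) (f : A → B) (xs : List A) →
             filter P? (map f xs) ≡ map f (filter (λ x → P? (f x)) xs)
filter-map P? f []       = refl
filter-map P? f (x ∷ xs) with does (P? (f x))
... | true  = cong (f x ∷_) (filter-map P? f xs)
... | false = filter-map P? f xs

filter-filter : (P? : Decidable P) (Q? : Decidable Q) (xs : List A) →
                filter Q? (filter P? xs) ≡ filter (λ x → P? x ×-dec Q? x) xs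
filter-filter P? Q? []       = refl
filter-filter P? Q? (x ∷ xs) with does (P? x)
... | false = filter-filter P? Q? xs
... | true with does (Q? x)
...   | true  = cong (x ∷_) (filter-filter P? Q? xs)
...   | false = filter-filter P? Q? xs

filter-comm : (P? : Decidable P) (Q? : Decidable Q) (xs : List A) →
              filter Q? (filter P? xs) ≡ filter P? (filter Q? xs)
filter-comm P? Q? xs =
  trans (filter-filter P? Q? xs)
 (trans (filter-≐ _ _ ((λ (p , q) → q , p) , (λ (q , p) → p , q)) xs)
        (sym (filter-filter Q? P? xs)))

-- In a list without repetition membership has at most one proof, so mutual inclusion is already a
-- bijection of positions. This turns equalities of sets of divisors into equalities of sums.
unique∧set⇒↭ : {xs ys : List A} → Unique xs → Unique ys →
               (∀ {x} → x ∈ xs → x ∈ ys) → (∀ {x} → x ∈ ys → x ∈ xs) → xs ↭ ys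
unique∧set⇒↭ xs! ys! to from = ∼bag⇒↭ (unique∧set⇒bag xs! ys! (mk⇔ to from))

-- Finite integer sums

∑ : (A → ℤ) → List A → ℤ
∑ f xs = foldr _+_ 0ℤ (map f xs)

∑-↭ : (f : A → ℤ) {xs ys : List A} → xs ↭ ys → ∑ f xs ≡ ∑ f ys
∑-↭ f xs↭ys = Permutation.foldr-commMonoid (setoid ℤ) ℤ.+-0-isCommutativeMonoid
                (↭⇒↭ₛ (map⁺ f xs↭ys))

∑-cong : {f g : A → ℤ} (xs : List A) → (∀ {x} → x ∈ xs → f x ≡ g x) → ∑ f xs ≡ ∑ g xs
∑-cong []       f≡g = refl
∑-cong (x ∷ xs) f≡g = cong₂ _+_ (f≡g (here refl)) (∑-cong xs (f≡g ∘ there))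

∑-++ : (f : A → ℤ) (xs ys : List A) → ∑ f (xs ++ ys) ≡ ∑ f xs + ∑ f ys
∑-++ f []       ys = sym (ℤ.+-identityˡ _)
∑-++ f (x ∷ xs) ys = trans (cong (_+_ (f x)) (∑-++ f xs ys)) (sym (ℤ.+-assoc (f x) _ _))

∑-map : (f : B → ℤ) (g : A → B) (xs : List A) → ∑ f (map g xs) ≡ ∑ (f ∘ g) xs
∑-map f g []       = refl
∑-map f g (x ∷ xs) = cong (_+_ (f (g x))) (∑-map f g xs)

-- Each `f x` that survives the filter meets its negative in the second sum. With `f e` = μ(e) and
-- `g e` = μ(p e) this is the cancellation in the Möbius sum.
∑-filter-cancel : (P? : Decidable P) {f g : A → ℤ} (xs : List A) →
  (∀ {x} → x ∈ xs → P x → g x ≡ - f x) → (∀ {x} → x ∈ xs → ¬ P x → g x ≡ 0ℤ) →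
  ∑ f (filter P? xs) + ∑ g xs ≡ 0ℤ
∑-filter-cancel P? []       g≡-f g≡0 = refl
∑-filter-cancel P? {f} {g} (x ∷ xs) g≡-f g≡0
  with ih ← ∑-filter-cancel P? xs (g≡-f ∘ there) (g≡0 ∘ there) | P? x
... | no ¬px rewrite g≡0 (here refl) ¬px =
  trans (cong (_+_ (∑ f (filter P? xs))) (ℤ.+-identityˡ (∑ g xs))) ih
... | yes px rewrite g≡-f (here refl) px =
  trans (rearrange (f x) (∑ f (filter P? xs)) (∑ g xs)) ih
  where
  rearrange : ∀ a b c → (a + b) + (- a + c) ≡ b + c
  rearrange = solve-∀

-- Later `h X` is a Möbius sum that is evaluated only for `X` in the given family, hence the
-- membership hypotheses.
∑-indicator : (P? : Decidable P) {h : A → ℤ} (xs : List A) →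
  (∀ {x} → x ∈ xs → P x → h x ≡ 1ℤ) → (∀ {x} → x ∈ xs → ¬ P x → h x ≡ 0ℤ) →
  + length (filter P? xs) ≡ ∑ h xs
∑-indicator P? []       h≡1 h≡0 = refl
∑-indicator P? {h} (x ∷ xs) h≡1 h≡0
  with ih ← ∑-indicator P? {h} xs (h≡1 ∘ there) (h≡0 ∘ there) | P? x
... | yes px = cong₂ _+_ (sym (h≡1 (here refl) px)) ih
... | no ¬px = trans ih (trans (sym (ℤ.+-identityˡ _))
                               (cong (_+ ∑ h xs) (sym (h≡0 (here refl) ¬px))))

-- Weighted double counting

module _ {R : A → B → Set} (R? : ∀ x y → Dec (R x y)) (w : A → ℤ) where

  weighted : List B → A → ℤ
  weighted ys x = w x * + length (filter (R? x) ys)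

  -- The new column `y` raises the count of row `x` by one exactly when `R x y` holds, and so adds
  -- `w x` for these rows.
  weighted-∷ : ∀ y ys xs →
    ∑ (weighted (y ∷ ys)) xs ≡ ∑ w (filter (λ x → R? x y) xs) + ∑ (weighted ys) xs
  weighted-∷ y ys []       = refl
  weighted-∷ y ys (x ∷ xs) with ih ← weighted-∷ y ys xs | does (R? x y)
  ... | false = trans (cong (_+_ (weighted ys x)) ih)
    (exchange (weighted ys x) (∑ w (filter (λ x → R? x y) xs)) (∑ (weighted ys) xs))
    where
    exchange : ∀ a b c → a + (b + c) ≡ b + (a + c)
    exchange = solve-∀
  ... | true  = trans (cong (_+_ (w x * (1ℤ + + length (filter (R? x) ys)))) ih)
    (rearrange (w x) (+ length (filter (R? x) ys)) (∑ w (filter (λ x → R? x y) xs))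
               (∑ (weighted ys) xs))
    where
    rearrange : ∀ a l b c → a * (1ℤ + l) + (b + c) ≡ (a + b) + (a * l + c)
    rearrange = solve-∀

  -- Both sides add `w x` over the related pairs, by rows on the left and by columns on the right.
  -- The induction removes one column at a time.
  double-counting : ∀ xs ys →
    ∑ (weighted ys) xs ≡ ∑ (λ y → ∑ w (filter (λ x → R? x y) xs)) ys
  double-counting xs []       = vanish xs
    where
    vanish : ∀ xs → ∑ (weighted []) xs ≡ 0ℤ
    vanish []       = refl
    vanish (x ∷ xs) = cong₂ _+_ (ℤ.*-zeroʳ (w x)) (vanish xs)
  double-counting xs (y ∷ ys) =
    trans (weighted-∷ y ys xs)
          (cong (_+_ (∑ w (filter (λ x → R? x y) xs))) (double-counting xs ys))

-- Divisors and the Möbius function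

-- The list inside `∑-divisors n`, so that `∑ f (D n)` is the divisor sum by definition.
D : ℕ → List ℕ
D n = filter (_∣? n) (upTo (suc n))

D-unique : ∀ n → Unique (D n)
D-unique n = Unique.filter⁺ (_∣? n) (Unique.upTo⁺ (suc n))

∈D⁺ : ∀ {n d} .{{_ : NonZero n}} → d ∣ n → d ∈ D n
∈D⁺ d∣n = ∈-filter⁺ (_∣? _) (∈-upTo⁺ (s≤s (∣⇒≤ d∣n))) d∣n

∈D⁻ : ∀ {n d} → d ∈ D n → d ∣ n
∈D⁻ {n} d∈D = proj₂ (∈-filter⁻ (_∣? n) {xs = upTo (suc n)} d∈D)

∣-nonZero : ∀ {d n} .{{_ : NonZero n}} → d ∣ n → NonZero d
∣-nonZero {zero}  {suc _} 0∣n = contradiction (0∣⇒≡0 0∣n) λ ()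
∣-nonZero {suc _}         _   = _

-- In p k = q d, Euclid's lemma puts p into q. Writing q = r p and cancelling p leaves k = r d.
prime∤⇒∣ : ∀ {p d} k → Prime p → ¬ (p ∣ d) → d ∣ p ℕ.* k → d ∣ k
prime∤⇒∣ {p} {d} k pp p∤d (divides q pk≡qd)
  with euclidsLemma q d pp (subst (p ∣_) pk≡qd (m∣m*n k))
... | inj₂ p∣d = contradiction p∣d p∤d
... | inj₁ (divides r refl) = divides r (ℕ.*-cancelˡ-≡ k (r ℕ.* d) p {{prime⇒nonZero pp}} (begin
  p ℕ.* k           ≡⟨ pk≡qd ⟩
  r ℕ.* p ℕ.* d     ≡⟨ cong (ℕ._* d) (ℕ.*-comm r p) ⟩
  p ℕ.* r ℕ.* d     ≡⟨ ℕ.*-assoc p r d ⟩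
  p ℕ.* (r ℕ.* d)   ∎))
  where open ≡-Reasoning

coprimeDivisors : ℕ → ℕ → List ℕ
coprimeDivisors p k = filter (λ d → ¬? (p ∣? d)) (D k)

-- Divisors are split by whether p divides them. The two pieces are disjoint, and multiplication by
-- p is injective, so the right side has no repetition either.
D-prime-* : ∀ {p} k .{{_ : NonZero k}} → Prime p →
            D (p ℕ.* k) ↭ coprimeDivisors p k ++ map (p ℕ.*_) (D k)
D-prime-* {p} k pp = unique∧set⇒↭ (D-unique (p ℕ.* k))
  (Unique.++⁺ (Unique.filter⁺ _ (D-unique k))
              (Unique.map⁺ (ℕ.*-cancelˡ-≡ _ _ p) (D-unique k)) disjoint)
  to from
  where
  instance
    _ = prime⇒nonZero pp
    _ = ℕ.m*n≢0 p k

  disjoint : ∀ {d} → ¬ (d ∈ coprimeDivisors p k × d ∈ map (p ℕ.*_) (D k))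
  disjoint (d∈ , d∈′) with ∈-map⁻ (p ℕ.*_) d∈′
  ... | e , _ , refl = proj₂ (∈-filter⁻ (λ d → ¬? (p ∣? d)) {xs = D k} d∈) (m∣m*n e)

  to : ∀ {d} → d ∈ D (p ℕ.* k) → d ∈ coprimeDivisors p k ++ map (p ℕ.*_) (D k)
  to {d} d∈ with p ∣? d
  ... | no p∤d = ∈-++⁺ˡ (∈-filter⁺ _ (∈D⁺ (prime∤⇒∣ k pp p∤d (∈D⁻ d∈))) p∤d)
  -- Divisibility supplies `e * p`, whereas the second list holds `p * e`.
  ... | yes (divides e refl) rewrite ℕ.*-comm e p =
    ∈-++⁺ʳ (coprimeDivisors p k) (∈-map⁺ (p ℕ.*_) (∈D⁺ (*-cancelˡ-∣ p (∈D⁻ d∈))))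

  from : ∀ {d} → d ∈ coprimeDivisors p k ++ map (p ℕ.*_) (D k) → d ∈ D (p ℕ.* k)
  from d∈ with ∈-++⁻ (coprimeDivisors p k) d∈
  ... | inj₁ d∈ˡ = ∈D⁺ (∣n⇒∣m*n p (∈D⁻ (proj₁ (∈-filter⁻ _ {xs = D k} d∈ˡ))))
  ... | inj₂ d∈ʳ with ∈-map⁻ (p ℕ.*_) d∈ʳ
  ...   | e , e∈ , refl = ∈D⁺ (*-monoʳ-∣ p (∈D⁻ e∈))

-- The formula in `μ`, detached from `factorise` so that it applies to any list of prime factors.
signature : List ℕ → ℤ
signature ps = if does (unique? ps) then -1ℤ ^ℤ length ps else 0ℤ

signature-↭ : ∀ {ps qs} → ps ↭ qs → signature ps ≡ signature qs
signature-↭ ps↭qs = cong₂ (λ b l → if b then -1ℤ ^ℤ l else 0ℤ)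
  (does-⇔ (mk⇔ (resp ps↭qs) (resp (↭-sym ps↭qs))) (unique? _) (unique? _))
  (↭-length ps↭qs)
  where
  resp : ∀ {ps qs} → ps ↭ qs → Unique ps → Unique qs
  resp ps↭qs = Permutation.Unique-resp-↭ (setoid ℕ) (↭⇒↭ₛ ps↭qs)

signature-∷-∈ : ∀ {p ps} → p ∈ ps → signature (p ∷ ps) ≡ 0ℤ
signature-∷-∈ {p} {ps} p∈ps
  rewrite dec-false (unique? (p ∷ ps)) (λ { (p∉ ∷ _) → All.lookup p∉ p∈ps refl }) = refl

-- A new entry leaves the outcome of the repetition test unchanged and contributes one more factor
-- -1.
signature-∷-∉ : ∀ {p ps} → ¬ (p ∈ ps) → signature (p ∷ ps) ≡ - signature ps
signature-∷-∉ {p} {ps} p∉ps =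
  trans (cong (if_then -1ℤ ^ℤ length (p ∷ ps) else 0ℤ)
              (does-⇔ (mk⇔ (λ { (_ ∷ ps!) → ps! })
                           (λ ps! → All.tabulate (λ { q∈ refl → p∉ps q∈ }) ∷ ps!))
                      (unique? (p ∷ ps)) (unique? ps)))
        (negate (does (unique? ps)))
  where
  negate : ∀ b → (if b then -1ℤ ^ℤ length (p ∷ ps) else 0ℤ)
               ≡ - (if b then -1ℤ ^ℤ length ps else 0ℤ)
  negate true  = ℤ.-1*i≡-i (-1ℤ ^ℤ length ps)
  negate false = refl

-- By unique factorisation `f` is a permutation of the factorisation chosen in `μ`.
μ-signature : ∀ {n} .{{_ : NonZero n}} (f : PrimeFactorisation n) → μ n ≡ signature (factors f)
μ-signature {suc n} f = signature-↭ (factorisationUnique (factorise (suc n)) f)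

module _ {p e : ℕ} .{{_ : NonZero e}} (pp : Prime p) where

  private
    instance
      _ = prime⇒nonZero pp
      _ = ℕ.m*n≢0 p e

    f : PrimeFactorisation e
    f = factorise e

    μ[p*e] : μ (p ℕ.* e) ≡ signature (p ∷ factors f)
    μ[p*e] = μ-signature (record
      { factors         = p ∷ factors f
      ; isFactorisation = cong (p ℕ.*_) (isFactorisation f)
      ; factorsPrime    = pp ∷ factorsPrime f })

  -- A prime dividing e occurs among the factors of e, so prepending it creates a repetition.
  μ-prime-*-∣ : p ∣ e → μ (p ℕ.* e) ≡ 0ℤ
  μ-prime-*-∣ p∣e = trans μ[p*e] (signature-∷-∈
    (factorisationHasAllPrimeFactors pp (subst (p ∣_) (isFactorisation f) p∣e) (factorsPrime f)))

  -- Every listed factor of e divides e, so p is not among them.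
  μ-prime-*-∤ : ¬ (p ∣ e) → μ (p ℕ.* e) ≡ - μ e
  μ-prime-*-∤ p∤e = trans μ[p*e] (trans
    (signature-∷-∉ {ps = factors f} (λ p∈ →
      p∤e (subst (p ∣_) (sym (isFactorisation f)) (∈⇒∣product p∈))))
    (cong -_ (sym (μ-signature f))))

∑μ-prime-* : ∀ {p} k .{{_ : NonZero k}} → Prime p → ∑ μ (D (p ℕ.* k)) ≡ 0ℤ
∑μ-prime-* {p} k pp = begin
  ∑ μ (D (p ℕ.* k))
    ≡⟨ ∑-↭ μ (D-prime-* k pp) ⟩
  ∑ μ (coprimeDivisors p k ++ map (p ℕ.*_) (D k))
    ≡⟨ ∑-++ μ (coprimeDivisors p k) _ ⟩
  ∑ μ (coprimeDivisors p k) + ∑ μ (map (p ℕ.*_) (D k))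
    ≡⟨ cong (_+_ (∑ μ (coprimeDivisors p k))) (∑-map μ (p ℕ.*_) (D k)) ⟩
  ∑ μ (coprimeDivisors p k) + ∑ (λ e → μ (p ℕ.* e)) (D k)
    ≡⟨ ∑-filter-cancel (λ d → ¬? (p ∣? d)) (D k)
         (λ e∈ → μ-prime-*-∤ {{∣-nonZero (∈D⁻ e∈)}} pp) onMultiples ⟩
  0ℤ ∎
  where
  open ≡-Reasoning
  onMultiples : ∀ {e} → e ∈ D k → ¬ ¬ (p ∣ e) → μ (p ℕ.* e) ≡ 0ℤ
  -- The filter tests for p ∤ e, so its failure is a double negation, removed by deciding p ∣ e.
  onMultiples {e} e∈ ¬p∤e with p ∣? e
  ... | yes p∣e = μ-prime-*-∣ {{∣-nonZero (∈D⁻ e∈)}} pp p∣e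
  ... | no  p∤e = contradiction p∤e ¬p∤e

-- The head of the factorisation serves as p and the product of its tail as k; an empty
-- factorisation would mean m = 1.
∑μ≡0 : ∀ {m} .{{_ : NonZero m}} → m ≢ 1 → ∑ μ (D m) ≡ 0ℤ
∑μ≡0 {m} m≢1 with factorise m
... | record { factors = [] ; isFactorisation = refl } = contradiction refl m≢1
... | record { factors = p ∷ ps ; isFactorisation = refl ; factorsPrime = pp ∷ _ } =
  ∑μ-prime-* _ {{ℕ.m*n≢0⇒n≢0 p}} pp

-- The sets V A d and gcds

∈V⁺ : ∀ {N} {A : Subset N} {d i} → i Subset.∈ A → d ∣ value i → i Subset.∈ V A d
∈V⁺ {d = d} {i} i∈A d∣i = x∈p∩q⁺ (i∈A , lookup⇒[]= i _
  (trans (lookup∘tabulate _ i) (dec-true (d ∣? value i) d∣i)))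

∈V⁻ : ∀ {N} (A : Subset N) d {i} → i Subset.∈ V A d → i Subset.∈ A × d ∣ value i
∈V⁻ A d {i} i∈V with x∈p∩q⁻ A _ i∈V
-- The equation says that the test for d returns `true`, which rules out the `no` case.
... | i∈A , i∈T with d ∣? value i | trans (sym (lookup∘tabulate _ i)) ([]=⇒lookup i∈T)
...   | yes d∣i | _ = i∈A , d∣i

∣foldr-gcd⁺ : ∀ {d n} xs → d ∣ n → (∀ {x} → x ∈ xs → d ∣ x) → d ∣ foldr gcd n xs
∣foldr-gcd⁺ []       d∣n _    = d∣n
∣foldr-gcd⁺ (x ∷ xs) d∣n d∣xs =
  gcd-greatest (d∣xs (here refl)) (∣foldr-gcd⁺ xs d∣n (d∣xs ∘ there))

foldr-gcd∣init : ∀ {n} xs → foldr gcd n xs ∣ n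
foldr-gcd∣init []       = ∣-refl
foldr-gcd∣init (x ∷ xs) = ∣-trans (gcd[m,n]∣n x _) (foldr-gcd∣init xs)

foldr-gcd∣∈ : ∀ {n x xs} → x ∈ xs → foldr gcd n xs ∣ x
foldr-gcd∣∈ {xs = y ∷ xs} (here refl) = gcd[m,n]∣m y _
foldr-gcd∣∈ {xs = y ∷ xs} (there x∈)  = ∣-trans (gcd[m,n]∣n y _) (foldr-gcd∣∈ x∈)

module _ {N : ℕ} (X : Subset N) (n : ℕ) where

  private
    elements : List ℕ
    elements = map value (filter (_∈? X) (allFin N))

  gcd∪∣n : gcd∪ X n ∣ n
  gcd∪∣n = foldr-gcd∣init elements

  gcd∪∣value : ∀ {i} → i Subset.∈ X → gcd∪ X n ∣ value i
  gcd∪∣value {i} i∈X =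
    foldr-gcd∣∈ {n} (∈-map⁺ value (∈-filter⁺ (_∈? X) (∈-allFin i) i∈X))

  ∣gcd∪ : ∀ {d} → d ∣ n → (∀ {i} → i Subset.∈ X → d ∣ value i) → d ∣ gcd∪ X n
  ∣gcd∪ {d} d∣n d∣X = ∣foldr-gcd⁺ elements d∣n d∣elements
    where
    d∣elements : ∀ {x} → x ∈ elements → d ∣ x
    d∣elements x∈ with ∈-map⁻ value x∈
    ... | i , i∈ , refl = d∣X (proj₂ (∈-filter⁻ (_∈? X) {xs = allFin N} i∈))

  -- As X ⊆ A, the inclusion X ⊆ V(A, d) says that d divides every member of X. With d ∣ n this
  -- makes d a common divisor of X ∪ {n}.
  D-gcd∪ : .{{_ : NonZero n}} (A : Subset N) → X Subset.⊆ A →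
           filter (λ d → X ⊆? V A d) (D n) ↭ D (gcd∪ X n)
  D-gcd∪ A X⊆A = unique∧set⇒↭ (Unique.filter⁺ _ (D-unique n)) (D-unique (gcd∪ X n)) to from
    where
    -- `∈D⁺` asks for a nonzero gcd; it is nonzero as a divisor of n.
    instance _ = ∣-nonZero gcd∪∣n

    to : ∀ {d} → d ∈ filter (λ d → X ⊆? V A d) (D n) → d ∈ D (gcd∪ X n)
    to {d} d∈ with ∈-filter⁻ (λ d → X ⊆? V A d) {xs = D n} d∈
    ... | d∈D , X⊆V = ∈D⁺ (∣gcd∪ (∈D⁻ d∈D) (λ i∈X → proj₂ (∈V⁻ A d (X⊆V i∈X))))

    from : ∀ {d} → d ∈ D (gcd∪ X n) → d ∈ filter (λ d → X ⊆? V A d) (D n)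
    from {d} d∈ = ∈-filter⁺ (λ d → X ⊆? V A d) (∈D⁺ (∣-trans (∈D⁻ d∈) gcd∪∣n))
      (λ {i} i∈X → ∈V⁺ (X⊆A i∈X) (∣-trans (∈D⁻ d∈) (gcd∪∣value i∈X)))

-- Möbius counting of the sets with gcd 1

möbius-count : ∀ {N} (A : Subset N) n .{{_ : NonZero n}} (L : List (Subset N)) →
  (∀ {X} → X ∈ L → X Subset.⊆ A) →
  + length (filter (λ X → gcd∪ X n ℕ.≟ 1) L)
    ≡ (∑[ d ∣ n ] (μ d * + length (filter (_⊆? V A d) L)))
möbius-count A n L L⊆A = trans
  (∑-indicator (λ X → gcd∪ X n ℕ.≟ 1) L
    -- The sum over `D 1` computes to μ(1) = 1.
    (λ {X} X∈L g≡1 → trans (inner X∈L) (cong (∑ μ ∘ D) g≡1))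
    (λ {X} X∈L g≢1 → trans (inner X∈L) (∑μ≡0 {{∣-nonZero (gcd∪∣n X n)}} g≢1)))
  (sym (double-counting (λ d X → X ⊆? V A d) μ (D n) L))
  where
  inner : ∀ {X} → X ∈ L → ∑ μ (filter (λ d → X ⊆? V A d) (D n)) ≡ ∑ μ (D (gcd∪ X n))
  inner {X} X∈L = ∑-↭ μ (D-gcd∪ X n A (L⊆A X∈L))

-- Power sets

-- A set that omits the first index is unconstrained there, so `s` is arbitrary and both `𝒫-outside`
-- and `𝒫-inside` can use this.
filter-⊆-outside : ∀ {N} s (S : Subset N) (L : List (Subset N)) →
  filter (_⊆? s Vec.∷ S) (map (outside Vec.∷_) L) ≡ map (outside Vec.∷_) (filter (_⊆? S) L)
filter-⊆-outside s S L = trans (filter-map (_⊆? s Vec.∷ S) (outside Vec.∷_) L)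
  (cong (map (outside Vec.∷_))
        (filter-≐ (λ Y → outside Vec.∷ Y ⊆? s Vec.∷ S) (_⊆? S)
                  ((λ Y⊆S → drop-∷-⊆ Y⊆S) , (λ Y⊆S → out⊆ Y⊆S)) L))

filter-⊆-inside : ∀ {N} (S : Subset N) (L : List (Subset N)) →
  filter (_⊆? inside Vec.∷ S) (map (inside Vec.∷_) L) ≡ map (inside Vec.∷_) (filter (_⊆? S) L)
filter-⊆-inside S L = trans (filter-map (_⊆? inside Vec.∷ S) (inside Vec.∷_) L)
  (cong (map (inside Vec.∷_))
        (filter-≐ (λ Y → inside Vec.∷ Y ⊆? inside Vec.∷ S) (_⊆? S)
                  ((λ Y⊆S → drop-∷-⊆ Y⊆S) , (λ Y⊆S → in⊆in Y⊆S)) L))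

𝒫-outside : ∀ {N} (S : Subset N) → 𝒫 (outside Vec.∷ S) ≡ map (outside Vec.∷_) (𝒫 S)
𝒫-outside {N} S = begin
  𝒫 (outside Vec.∷ S)
    ≡⟨ filter-++ (_⊆? outside Vec.∷ S) (map (outside Vec.∷_) (subsets N)) _ ⟩
  filter (_⊆? outside Vec.∷ S) (map (outside Vec.∷_) (subsets N)) ++
  filter (_⊆? outside Vec.∷ S) (map (inside Vec.∷_) (subsets N))
    ≡⟨ cong₂ _++_ (filter-⊆-outside outside S (subsets N)) (trans
         (filter-map (_⊆? outside Vec.∷ S) (inside Vec.∷_) (subsets N))
         (cong (map _) (filter-none (λ Y → inside Vec.∷ Y ⊆? outside Vec.∷ S)
                                 (All.universal inside⊈ (subsets N))))) ⟩
  map (outside Vec.∷_) (𝒫 S) ++ []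
    ≡⟨ ++-identityʳ _ ⟩
  map (outside Vec.∷_) (𝒫 S) ∎
  where
  open ≡-Reasoning
  inside⊈ : ∀ Y → ¬ ((inside Vec.∷ Y) Subset.⊆ (outside Vec.∷ S))
  inside⊈ Y Y⊆S with Y⊆S Vec.here
  ... | ()

𝒫-inside : ∀ {N} (S : Subset N) →
  𝒫 (inside Vec.∷ S) ≡ map (outside Vec.∷_) (𝒫 S) ++ map (inside Vec.∷_) (𝒫 S)
𝒫-inside {N} S = trans
  (filter-++ (_⊆? inside Vec.∷ S) (map (outside Vec.∷_) (subsets N)) _)
  (cong₂ _++_ (filter-⊆-outside inside S (subsets N)) (filter-⊆-inside S (subsets N)))

length-𝒫 : ∀ {N} (S : Subset N) → length (𝒫 S) ≡ 2 ^ ∣ S ∣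
length-𝒫 Vec.[]          = refl
length-𝒫 (false Vec.∷ S) =
  trans (cong length (𝒫-outside S)) (trans (length-map _ (𝒫 S)) (length-𝒫 S))
length-𝒫 (true Vec.∷ S)  = begin
  length (𝒫 (inside Vec.∷ S))
    ≡⟨ cong length (𝒫-inside S) ⟩
  length (map (outside Vec.∷_) (𝒫 S) ++ map (inside Vec.∷_) (𝒫 S))
    ≡⟨ length-++ (map (outside Vec.∷_) (𝒫 S)) ⟩
  length (map (outside Vec.∷_) (𝒫 S)) ℕ.+ length (map (inside Vec.∷_) (𝒫 S))
    -- `2 * m` unfolds to `m + (m + 0)`.
    ≡⟨ cong₂ ℕ._+_ (half outside) (trans (half inside) (sym (ℕ.+-identityʳ _))) ⟩
  2 ℕ.* 2 ^ ∣ S ∣ ∎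
  where
  open ≡-Reasoning
  half : ∀ s → length (map (s Vec.∷_) (𝒫 S)) ≡ 2 ^ ∣ S ∣
  half s = trans (length-map _ (𝒫 S)) (length-𝒫 S)

-- The size filter of `𝒫[_]` on an arbitrary list, so that it can be moved through `map` and `++`.
ofSize : ∀ {N} → ℕ → List (Subset N) → List (Subset N)
ofSize α = filter (λ Y → ∣ Y ∣ ℕ.≟ α)

length-ofSize-outside : ∀ {N} α (L : List (Subset N)) →
  length (ofSize α (map (outside Vec.∷_) L)) ≡ length (ofSize α L)
length-ofSize-outside α L =
  trans (cong length (filter-map _ (outside Vec.∷_) L)) (length-map _ (ofSize α L))

length-ofSize-zero-inside : ∀ {N} (L : List (Subset N)) →
  length (ofSize 0 (map (inside Vec.∷_) L)) ≡ 0
length-ofSize-zero-inside L = trans (cong length (filter-map _ (inside Vec.∷_) L))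
  (cong (length ∘ map _) (filter-none _ (All.universal (λ _ ()) L)))

length-ofSize-suc-inside : ∀ {N} α (L : List (Subset N)) →
  length (ofSize (suc α) (map (inside Vec.∷_) L)) ≡ length (ofSize α L)
length-ofSize-suc-inside α L =
  trans (cong length (filter-map _ (inside Vec.∷_) L)) (trans
    (length-map _ (filter (λ Y → suc ∣ Y ∣ ℕ.≟ suc α) L))
    (cong length (filter-≐ _ (λ Y → ∣ Y ∣ ℕ.≟ α) (ℕ.suc-injective , cong suc) L)))

-- Pascal's rule: when the first index lies in S, a subset of size α either omits it or contains it
-- along with α - 1 others.
length-𝒫[] : ∀ {N} α (S : Subset N) → length (𝒫[ α ] S) ≡ ∣ S ∣ C α
length-𝒫[] zero    Vec.[]          = refl
length-𝒫[] (suc α) Vec.[]          = refl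
length-𝒫[] α       (false Vec.∷ S) = trans (cong (length ∘ ofSize α) (𝒫-outside S))
  (trans (length-ofSize-outside α (𝒫 S)) (length-𝒫[] α S))
length-𝒫[] α       (true Vec.∷ S)  = begin
  length (𝒫[ α ] (inside Vec.∷ S))
    ≡⟨ cong (length ∘ ofSize α) (𝒫-inside S) ⟩
  length (ofSize α (map (outside Vec.∷_) (𝒫 S) ++ map (inside Vec.∷_) (𝒫 S)))
    ≡⟨ cong length (filter-++ _ (map (outside Vec.∷_) (𝒫 S)) _) ⟩
  length (ofSize α (map (outside Vec.∷_) (𝒫 S)) ++ ofSize α (map (inside Vec.∷_) (𝒫 S)))
    ≡⟨ length-++ (ofSize α (map (outside Vec.∷_) (𝒫 S))) ⟩
  length (ofSize α (map (outside Vec.∷_) (𝒫 S))) ℕ.+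
  length (ofSize α (map (inside Vec.∷_) (𝒫 S)))
    ≡⟨ cong₂ ℕ._+_ (trans (length-ofSize-outside α (𝒫 S)) (length-𝒫[] α S)) refl ⟩
  ∣ S ∣ C α ℕ.+ length (ofSize α (map (inside Vec.∷_) (𝒫 S)))
    ≡⟨ pascal α ⟩
  suc ∣ S ∣ C α ∎
  where
  open ≡-Reasoning
  pascal : ∀ α → ∣ S ∣ C α ℕ.+ length (ofSize α (map (inside Vec.∷_) (𝒫 S))) ≡ suc ∣ S ∣ C α
  -- No set containing the first index has size 0, and `∣ S ∣ C 0 + 0` agrees with `suc ∣ S ∣ C 0`
  -- by computation.
  pascal zero    = cong (∣ S ∣ C 0 ℕ.+_) (length-ofSize-zero-inside (𝒫 S))
  pascal (suc α) = begin
    ∣ S ∣ C suc α ℕ.+ length (ofSize (suc α) (map (inside Vec.∷_) (𝒫 S)))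
      ≡⟨ cong (∣ S ∣ C suc α ℕ.+_)
              (trans (length-ofSize-suc-inside α (𝒫 S)) (length-𝒫[] α S)) ⟩
    ∣ S ∣ C suc α ℕ.+ ∣ S ∣ C α
      ≡⟨ ℕ.+-comm (∣ S ∣ C suc α) _ ⟩
    ∣ S ∣ C α ℕ.+ ∣ S ∣ C suc α
      ≡⟨ nCk+nC[k+1]≡[n+1]C[k+1] ∣ S ∣ α ⟩
    suc ∣ S ∣ C suc α ∎

-- Passing from subsets of A to subsets of V(A, d)

filter-⊆-𝒫 : ∀ {N} {S A : Subset N} → S Subset.⊆ A → filter (_⊆? S) (𝒫 A) ≡ 𝒫 S
filter-⊆-𝒫 {N} {S} {A} S⊆A = trans (filter-filter (_⊆? A) (_⊆? S) (subsets N))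
  (filter-≐ (λ Y → (Y ⊆? A) ×-dec (Y ⊆? S)) (_⊆? S)
    ((λ (_ , Y⊆S) → Y⊆S) , λ Y⊆S → (λ {i} i∈Y → S⊆A (Y⊆S i∈Y)) , λ {i} → Y⊆S) (subsets N))

V⊆ : ∀ {N} (A : Subset N) d → V A d Subset.⊆ A
V⊆ A d i∈V = proj₁ (∈V⁻ A d i∈V)

filter-⊆-𝒫[] : ∀ {N} α {S A : Subset N} → S Subset.⊆ A →
               filter (_⊆? S) (𝒫[ α ] A) ≡ 𝒫[ α ] S
filter-⊆-𝒫[] α {S} {A} S⊆A = trans (filter-comm (λ Y → ∣ Y ∣ ℕ.≟ α) (_⊆? S) (𝒫 A))
                                   (cong (ofSize α) (filter-⊆-𝒫 S⊆A))

∈𝒫⇒⊆ : ∀ {N} (A : Subset N) {X} → X ∈ 𝒫 A → X Subset.⊆ A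
∈𝒫⇒⊆ {N} A X∈ = proj₂ (∈-filter⁻ (_⊆? A) {xs = subsets N} X∈)

-- Without members of X to divide, n is itself a common divisor, so it and the gcd divide each
-- other.
gcd∪-empty : ∀ {N} {X : Subset N} n → ¬ Nonempty X → gcd∪ X n ≡ n
gcd∪-empty {X = X} n X≡∅ = ∣-antisym (gcd∪∣n X n)
  (∣gcd∪ X n ∣-refl (λ i∈X → contradiction (_ , i∈X) X≡∅))

-- The empty set has gcd n, so for n different from 1 a set with gcd 1 is nonempty. This is where
-- `n ≢ 1` enters part (a).
Φ-gcd : ∀ {N} (A : Subset N) n → n ≢ 1 →
        Φ A n ≡ length (filter (λ X → gcd∪ X n ℕ.≟ 1) (𝒫 A))
Φ-gcd A n n≢1 = cong length (filter-≐ _ _ (proj₂ , λ g≡1 → nonempty g≡1 , g≡1) (𝒫 A))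
  where
  nonempty : ∀ {X} → gcd∪ X n ≡ 1 → Nonempty X
  nonempty {X} g≡1 with nonempty? X
  ... | yes X≢∅ = X≢∅
  ... | no  X≡∅ = contradiction (trans (sym (gcd∪-empty n X≡∅)) g≡1) n≢1

∑-divisors-cong : ∀ n {f g : ℕ → ℕ} → (∀ d → f d ≡ g d) →
                  (∑[ d ∣ n ] (μ d * + f d)) ≡ (∑[ d ∣ n ] (μ d * + g d))
∑-divisors-cong n f≡g = ∑-cong (D n) (λ {d} _ → cong (λ k → μ d * + k) (f≡g d))

theorem2p1 : ∀ {N : ℕ} (A : Subset N) → Nonempty A →
    (n : ℕ) .{{_ : NonZero n}} (α : ℕ) .{{_ : NonZero α}} → α ≤ ∣ A ∣ →
    ((n ≢ 1 → + Φ A n ≡ (∑[ d ∣ n ] (μ d * + (2 ^ v A d))))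
    × (∑[ d ∣ n ] (μ d * + (2 ^ v A d))) ≡ (∑[ d ∣ n ] (μ d * + length (𝒫 (V A d)))))
    × (+ Φ[ α ] A n ≡ (∑[ d ∣ n ] (μ d * + (v A d C α)))
    × (∑[ d ∣ n ] (μ d * + (v A d C α))) ≡ (∑[ d ∣ n ] (μ d * + length (𝒫[ α ] (V A d)))))
theorem2p1 A _ n α _ =
    ( (λ n≢1 → trans (cong +_ (Φ-gcd A n n≢1))
         (trans (möbius-count A n (𝒫 A) (∈𝒫⇒⊆ A))
                (∑-divisors-cong n (λ d →
                   trans (cong length (filter-⊆-𝒫 (V⊆ A d))) (length-𝒫 (V A d))))))
    , ∑-divisors-cong n (λ d → sym (length-𝒫 (V A d))))
  -- `Φ[ α ] A n` is the left side of `möbius-count` for this family by definition.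
  , ( trans (möbius-count A n (𝒫[ α ] A)
               (λ X∈ → ∈𝒫⇒⊆ A (proj₁ (∈-filter⁻ (λ Y → ∣ Y ∣ ℕ.≟ α) {xs = 𝒫 A} X∈))))
            (∑-divisors-cong n (λ d →
               trans (cong length (filter-⊆-𝒫[] α (V⊆ A d))) (length-𝒫[] α (V A d))))
    , ∑-divisors-cong n (λ d → sym (length-𝒫[] α (V A d))))
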